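{- Let $\sigma$ and $\pi$ be permutations, let $m_1=(\sigma,R_1)$ and $m_2=(\sigma,R_2)$ be mesh patterns with the same underlying classical pattern $\sigma$, and regard $\pi=(\pi,\emptyset)$ as a (dominating) classical pattern. Suppose there is a box $(a,b)\in[0,|\sigma|]\times[0,|\sigma|]$ with $(a,b)\notin R_1$ such that 1. $R_2=R_1\cup\{(a,b)\}$, and 2. at least one of the five mesh patterns in the set $m_1^{(a,b)\star}$ is coincident under $\pi$ with a mesh pattern that contains $m_2$ as a subpattern. Then $m_1$ and $m_2$ are coincident under $\pi$, i.e. $\mathrm{Av}(\{\pi,m_1\})=\mathrm{Av}(\{\pi,m_2\})$.
   Context: Write $[n]=\{1,\dots,n\}$ and $[0,k]=\{0,1,\dots,k\}$. A permutation of length $n$ is a bijection of $[n]$, written in one-line notation; $|\sigma|$ is the length of $\sigma$ and $G(\sigma)=\{(i,\sigma(i)) : i\in[n]\}$ is its plot. A mesh pattern of length $k$ is a pair $p=(\tau,R)$ with $\tau$ a permutation of length $k$ (the underlying classical pattern) and $R\subseteq[0,k]\times[0,k]$; the element $(i,j)$ of $[0,k]\times[0,k]$ denotes the unit box with lower left corner $(i,j)$. An occurrence of $p$ in a permutation $\pi$ of length $n$ is a subset $\omega\subseteq G(\pi)$ for which there are order-preserving injections $\alpha,\beta:[k]\to[n]$ such that (i) $\omega=\{(\alpha(i),\beta(j)):(i,j)\in G(\tau)\}$, and (ii) with $\alpha(0)=\beta(0)=0$, $\alpha(k+1)=\beta(k+1)=n+1$ and $R_{ij}=[\alpha(i)+1,\alpha(i+1)-1]\times[\beta(j)+1,\beta(j+1)-1]$,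 one has $R_{ij}\cap G(\pi)=\emptyset$ for every $(i,j)\in R$. A permutation contains $p$ if it has an occurrence of $p$, and avoids $p$ otherwise. A classical pattern $\pi$ is identified with the mesh pattern $(\pi,\emptyset)$. $\mathrm{Av}(S)$ is the set of all permutations (of all lengths) avoiding every pattern in $S$. Two mesh patterns $p_1,p_2$ (possibly of different lengths) are coincident under $\pi$ if $\mathrm{Av}(\{\pi,p_1\})=\mathrm{Av}(\{\pi,p_2\})$. A mesh pattern $q=(\kappa,T)$ contains a mesh pattern $p=(\tau,R)$ as a subpattern if there is an occurrence $\omega\subseteq G(\kappa)$ of $p$ in the permutation $\kappa$, with associated order-preserving injections $\alpha,\beta:[|\tau|]\to[|\kappa|]$ satisfying $\omega=\{(\alpha(i),\beta(j)):(i,j)\in G(\tau)\}$ and extended by $\alpha(0)=\beta(0)=0$, $\alpha(|\tau|+1)=\beta(|\tau|+1)=|\kappa|+1$, such that moreover for every $(i,j)\in R$ all boxes $(u,v)$ with $\alpha(i)\le u\le\alpha(i+1)-1$ and $\beta(j)\le v\le\beta(j+1)-1$ (the boxes making up the region corresponding to $(i,j)$) belong to $T$. Point insertion: let $p=(\tau,R)$ be a mesh pattern of length $n$ and $(i,j)\notin R$ a box. Then $p^{(i,j)}=(\tau',R')$ is the mesh pattern of length $n+1$ where $\tau'(i+1)=j+1$; for $k\le i$, $\tau'(k)=\tau(k)$ if $\tau(k)\le j$ and $\tau(k)+1$ otherwise; for $k>i+1$, $\tau'(k)=\tau(k-1)$ if $\tau(k-1)\le j$ and $\tau(k-1)+1$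 otherwise; and $R'$ is the set of boxes $(k,\ell)\in[0,n+1]^2$ such that $(k^*,\ell^*)\in R$, where $k^*=k$ if $k\le i$, $k^*=k-1$ if $k>i$, $\ell^*=\ell$ if $\ell\le j$, $\ell^*=\ell-1$ if $\ell>j$. The set $p^{(i,j)\star}$ consists of the five mesh patterns $(\tau',R')$, $(\tau',R'\cup\{(i,j+1),(i+1,j+1)\})$, $(\tau',R'\cup\{(i+1,j),(i+1,j+1)\})$, $(\tau',R'\cup\{(i,j),(i+1,j)\})$, $(\tau',R'\cup\{(i,j),(i,j+1)\})$. -}

module Defs where

open import Data.Fin using (Fin; zero; suc; toℕ; fromℕ; inject₁; pinch)
import Data.Fin as Fin
open import Data.Fin.Permutation using (Permutation′; _⟨$⟩ʳ_; insert)
open import Data.List using (List; _∷_; [])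
open import Data.Nat using (ℕ; suc; _≤_; _<_)
open import Data.Product using (Σ-syntax; ∃; ∃₂; _×_; _,_)
import Data.Vec.Functional as Vector
open import Function.Definitions using (Injective)
open import Level using (Level; 0ℓ)
open import Relation.Binary.Core using (_Preserves_⟶_)
open import Relation.Binary.PropositionalEquality using (_≡_)
open import Relation.Nullary using (¬_)
open import Relation.Unary using (Pred; _∈_; _⊆_; _≐_; _∪_; _∩_; ∅; ｛_｝; Empty)

private
  variable
    ℓ   : Level
    k n : ℕ

-- Positions and values are counted from 0 in Fin n, whereas [n] starts at 1:
-- x : Fin n stands for the element coord x of [n].
coord : Fin n → ℕ
coord x = suc (toℕ x)

Plot : Permutation′ n → Pred (Fin n × Fin n) 0ℓ
Plot ρ (x , y) = ρ ⟨$⟩ʳ x ≡ y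

-- The unit box with lower left corner (i , j), 0 ≤ i , j ≤ k.
Box : ℕ → Set
Box k = Fin (suc k) × Fin (suc k)

Shading : ℕ → Set₁
Shading k = Pred (Box k) 0ℓ

record MeshPattern : Set₁ where
  constructor mesh
  field
    {size}  : ℕ
    perm    : Permutation′ size
    shading : Shading size

open MeshPattern

classical : Permutation′ n → MeshPattern
classical π = mesh π ∅

OrderPreservingInjection : (Fin k → Fin n) → Set
OrderPreservingInjection α = α Preserves Fin._≤_ ⟶ Fin._≤_ × Injective _≡_ _≡_ α

-- α as a map [0,k+1] → [0,n+1], with α(0) = 0 and α(k+1) = n+1.
extend : (Fin k → Fin n) → Fin (suc (suc k)) → ℕ
extend {k} {n} α = 0 Vector.∷ Vector.insertAt (λ i → coord (α i)) (fromℕ k) (suc n)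

Image : (Fin k → Fin n) → (Fin k → Fin n) → Permutation′ k → Pred (Fin n × Fin n) 0ℓ
Image α β τ (x , y) = ∃₂ λ i j → (i , j) ∈ Plot τ × x ≡ α i × y ≡ β j

-- R_ij = [α(i)+1 , α(i+1)-1] × [β(j)+1 , β(j+1)-1].
Region : (Fin k → Fin n) → (Fin k → Fin n) → Box k → Pred (Fin n × Fin n) 0ℓ
Region α β (i , j) (x , y) =
  (extend α (inject₁ i) < coord x × coord x < extend α (suc i)) ×
  (extend β (inject₁ j) < coord y × coord y < extend β (suc j))

-- The point set ω of an occurrence is determined by α, β and the pattern.
record Occurrence (p : MeshPattern) (ρ : Permutation′ n) : Set where
  field
    α β     : Fin (size p) → Fin n
    α-order : OrderPreservingInjection α
    β-order : OrderPreservingInjection β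

  ω : Pred (Fin n × Fin n) 0ℓ
  ω = Image α β (perm p)

  field
    ω⊆plot      : ω ⊆ Plot ρ
    shaded-free : ∀ {b} → b ∈ shading p → Empty (Region α β b ∩ Plot ρ)

Perm : Set
Perm = ∃ Permutation′

_Contains_ : Perm → MeshPattern → Set
(_ , ρ) Contains p = Occurrence p ρ

_Avoids_ : Perm → MeshPattern → Set
ρ Avoids p = ¬ (ρ Contains p)

Av : Pred MeshPattern ℓ → Pred Perm _
Av S ρ = ∀ {p} → p ∈ S → ρ Avoids p

CoincidentUnder : Permutation′ n → MeshPattern → MeshPattern → Set₁
CoincidentUnder π p₁ p₂ =
  Av (｛ classical π ｝ ∪ ｛ p₁ ｝) ≐ Av (｛ classical π ｝ ∪ ｛ p₂ ｝)

-- The boxes of the larger pattern that make up the region of a box (i , j);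
-- u ≤ α(i+1)-1 is written u < α(i+1).
Subdivision : (Fin k → Fin n) → (Fin k → Fin n) → Box k → Pred (Box n) 0ℓ
Subdivision α β (i , j) (u , v) =
  (extend α (inject₁ i) ≤ toℕ u × toℕ u < extend α (suc i)) ×
  (extend β (inject₁ j) ≤ toℕ v × toℕ v < extend β (suc j))

_IsSubpatternOf_ : MeshPattern → MeshPattern → Set
p IsSubpatternOf q =
  Σ[ o ∈ Occurrence p (perm q) ]
    (∀ {b} → b ∈ shading p →
      Subdivision (Occurrence.α o) (Occurrence.β o) b ⊆ shading q)

-- pinch i k is k if k ≤ i and k - 1 if k > i.
insertShading : Shading k → Box k → Shading (suc k)
insertShading R (i , j) (u , v) = (pinch i u , pinch j v) ∈ R

-- With positions and values counted from 0, the new point (i+1 , j+1) is the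
-- pair (i , j) of Fin (suc k); insert shifts the other positions ≥ i and
-- values ≥ j up by one.  Total in the box: that it is unshaded is left to the
-- users of the definition.
insertPoint : (p : MeshPattern) → Box (size p) → MeshPattern
insertPoint (mesh τ R) (i , j) = mesh (insert i j τ) (insertShading R (i , j))

shade₂ : (p : MeshPattern) → Box (size p) → Box (size p) → MeshPattern
shade₂ (mesh τ R) b c = mesh τ (R ∪ (｛ b ｝ ∪ ｛ c ｝))

star : (p : MeshPattern) → Box (size p) → List MeshPattern
star p (i , j) =
    p′
  ∷ shade₂ p′ (i₀ , j₁) (i₁ , j₁)
  ∷ shade₂ p′ (i₁ , j₀) (i₁ , j₁)
  ∷ shade₂ p′ (i₀ , j₀) (i₁ , j₀)
  ∷ shade₂ p′ (i₀ , j₀) (i₀ , j₁)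
  ∷ []
  where
  p′ : MeshPattern
  p′ = insertPoint p (i , j)

  i₀ i₁ j₀ j₁ : Fin (suc (suc (size p)))
  i₀ = inject₁ i
  i₁ = suc i
  j₀ = inject₁ j
  j₁ = suc j

{-# OPTIONS --safe #-}

-- An occurrence of m₂ is one of m₁, as R₁ ⊆ R₂.  Conversely, let ρ avoid π and
-- m₂ but have an occurrence of m₁.  The region of the box c must contain a
-- point of ρ.  Adding to the occurrence an arbitrary, or the topmost,
-- rightmost, bottommost or leftmost point of this region gives an occurrence of
-- the respective pattern of the star, so ρ contains each of them.  One of them
-- is coincident under π with some q containing m₂, hence ρ contains q and
-- therefore m₂, a contradiction.
module Submission where

open import Defs
open import Data.Fin using (Fin; zero; suc; toℕ; fromℕ; inject₁; pinch; punchIn)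
import Data.Fin as Fin
open import Data.Fin.Permutation
  using (Permutation′; _⟨$⟩ʳ_; _⟨$⟩ˡ_; inverseʳ; insert; insert-punchIn)
import Data.Fin.Properties as Fin
open import Data.Fin.Relation.Unary.Top using (view; ‵fromℕ; ‵inject₁)
open import Data.List using (allFin; filter)
import Data.List.Extrema as Extrema
open import Data.List.Membership.Propositional.Properties using (∈-filter⁺; ∈-allFin)
open import Data.List.Relation.Unary.All as All using (All; []; _∷_)
open import Data.List.Relation.Unary.All.Properties using (all-filter)
open import Data.List.Relation.Unary.Any using (Any)
open import Data.Nat using (ℕ; zero; suc; _≤_; _<_; z≤n; s≤s; s≤s⁻¹; _<?_)
import Data.Nat.Properties as ℕ
open import Data.Product using (∃; ∃-syntax; _×_; _,_; proj₁; proj₂)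
open import Data.Sum using (_⊎_; inj₁; inj₂)
import Data.Vec.Functional as Vector
open import Data.Vec.Functional.Properties using (insertAt-lookup; insertAt-punchIn)
open import Function using (_∘_; id)
open import Function.Bundles using (Injection)
open import Function.Properties.Inverse using (↔⇒↣)
open import Level using (0ℓ)
open import Relation.Binary.Bundles using (TotalOrder)
open import Relation.Binary.Core using (_Preserves_⟶_)
open import Relation.Binary.Definitions using (tri<; tri≈; tri>)
import Relation.Binary.Construct.Flip.EqAndOrd as Flip
open import Relation.Binary.PropositionalEquality
  using (_≡_; refl; sym; trans; cong; subst; subst₂)
open import Relation.Nullary using (¬_; yes; no; contradiction; _×-dec_)
open import Relation.Unary using (Pred; Decidable; Empty; _∈_; _∉_; _⊆_; _≐_; _∪_; _∩_; ｛_｝)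

open MeshPattern
open Occurrence

private
  variable
    k l n : ℕ

-- Order-preserving and strictly monotone maps

StrictlyMonotone : (Fin k → Fin n) → Set
StrictlyMonotone α = α Preserves Fin._<_ ⟶ Fin._<_

strictlyMonotone⇒opi : {α : Fin k → Fin n} → StrictlyMonotone α → OrderPreservingInjection α
strictlyMonotone⇒opi {α = α} mono = preserves , injective
  where
  preserves : α Preserves Fin._≤_ ⟶ Fin._≤_
  preserves {a} {b} a≤b with a Fin.≟ b
  ... | yes refl = ℕ.≤-refl
  ... | no  a≢b  = ℕ.<⇒≤ (mono (Fin.≤∧≢⇒< a≤b a≢b))

  injective : ∀ {a b} → α a ≡ α b → a ≡ b
  injective {a} {b} eq with Fin.<-cmp a b
  ... | tri< a<b _ _ = contradiction (mono a<b) (ℕ.<-irrefl (cong toℕ eq))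
  ... | tri≈ _ a≡b _ = a≡b
  ... | tri> _ _ b<a = contradiction (mono b<a) (ℕ.<-irrefl (cong toℕ (sym eq)))

opi⇒strictlyMonotone : {α : Fin k → Fin n} → OrderPreservingInjection α → StrictlyMonotone α
opi⇒strictlyMonotone (preserves , injective) a<b =
  Fin.≤∧≢⇒< (preserves (ℕ.<⇒≤ a<b)) (λ eq → ℕ.<-irrefl (cong toℕ (injective eq)) a<b)

opi-∘ : {α : Fin l → Fin n} {γ : Fin k → Fin l} →
        OrderPreservingInjection α → OrderPreservingInjection γ →
        OrderPreservingInjection (α ∘ γ)
opi-∘ (α≤ , α-inj) (γ≤ , γ-inj) = α≤ ∘ γ≤ , γ-inj ∘ α-inj

-- Grid lines: an injection extended by its boundary values

insertAt-inject₁ : ∀ {A : Set} (xs : Vector.Vector A k) (v : A) (i : Fin k) →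
                   Vector.insertAt xs (fromℕ k) v (inject₁ i) ≡ xs i
insertAt-inject₁ xs v zero    = refl
insertAt-inject₁ xs v (suc i) = insertAt-inject₁ (Vector.tail xs) v i

module _ (α : Fin k → Fin n) where

  extend-inject₁ : ∀ i → extend α (suc (inject₁ i)) ≡ coord (α i)
  extend-inject₁ = insertAt-inject₁ (coord ∘ α) (suc n)

  extend-fromℕ : extend α (suc (fromℕ k)) ≡ suc n
  extend-fromℕ = insertAt-lookup (coord ∘ α) (fromℕ k) (suc n)

  extend≤ : ∀ t → extend α t ≤ suc n
  extend≤ zero = z≤n
  extend≤ (suc t) with view t
  ... | ‵fromℕ     = ℕ.≤-reflexive extend-fromℕ
  ... | ‵inject₁ i = ℕ.≤-trans (ℕ.≤-reflexive (extend-inject₁ i)) (s≤s (ℕ.<⇒≤ (Fin.toℕ<n (α i))))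

  extend-mono : α Preserves Fin._≤_ ⟶ Fin._≤_ → extend α Preserves Fin._≤_ ⟶ _≤_
  extend-mono α≤ {zero}          _ = z≤n
  extend-mono α≤ {suc s} {suc t} (s≤s s≤t) with view s | view t
  ... | _          | ‵fromℕ     = ℕ.≤-trans (extend≤ (suc s)) (ℕ.≤-reflexive (sym extend-fromℕ))
  ... | ‵fromℕ     | ‵inject₁ j =
    contradiction (subst₂ _≤_ (Fin.toℕ-fromℕ k) (Fin.toℕ-inject₁ j) s≤t) (ℕ.<⇒≱ (Fin.toℕ<n j))
  ... | ‵inject₁ i | ‵inject₁ j =
    subst₂ _≤_ (sym (extend-inject₁ i)) (sym (extend-inject₁ j))
      (s≤s (α≤ (subst₂ _≤_ (Fin.toℕ-inject₁ i) (Fin.toℕ-inject₁ j) s≤t)))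

-- The values of extend γ can themselves be used as indices of extend δ.
extend-∘ : (α : Fin k → Fin n) (δ : Fin l → Fin n) (γ : Fin k → Fin l) →
           (∀ i → δ (γ i) ≡ α i) →
           ∀ t → ∃[ t′ ] (toℕ t′ ≡ extend γ t × extend δ t′ ≡ extend α t)
extend-∘ α δ γ eq zero = zero , refl , refl
extend-∘ {l = l} α δ γ eq (suc t) with view t
... | ‵fromℕ     =
  suc (fromℕ l) ,
  trans (cong suc (Fin.toℕ-fromℕ l)) (sym (extend-fromℕ γ)) ,
  trans (extend-fromℕ δ) (sym (extend-fromℕ α))
... | ‵inject₁ i =
  suc (inject₁ (γ i)) ,
  trans (cong suc (Fin.toℕ-inject₁ (γ i))) (sym (extend-inject₁ γ i)) ,
  trans (extend-inject₁ δ (γ i)) (trans (cong coord (eq i)) (sym (extend-inject₁ α i)))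

module _ {α : Fin k → Fin n} {δ : Fin l → Fin n} (γ : Fin k → Fin l)
         (δ≤ : δ Preserves Fin._≤_ ⟶ Fin._≤_) (eq : ∀ i → δ (γ i) ≡ α i) where

  -- `extend γ t` is itself the index of a grid line of `δ`, and that line coincides with line `t`
  -- of `α`; hence monotonicity of `extend δ` turns comparisons of indices into comparisons of
  -- coordinates.
  extend-∘-≤ : ∀ {s t} → extend γ t ≤ toℕ s → extend α t ≤ extend δ s
  extend-∘-≤ {s} {t} γt≤s with extend-∘ α δ γ eq t
  ... | t′ , p , q =
    subst (_≤ extend δ s) q (extend-mono δ δ≤ (ℕ.≤-trans (ℕ.≤-reflexive p) γt≤s))

  extend-∘-≥ : ∀ {s t} → toℕ s ≤ extend γ t → extend δ s ≤ extend α t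
  extend-∘-≥ {s} {t} s≤γt with extend-∘ α δ γ eq t
  ... | t′ , p , q =
    subst (extend δ s ≤_) q (extend-mono δ δ≤ (ℕ.≤-trans s≤γt (ℕ.≤-reflexive (sym p))))

-- Strips between consecutive grid lines and their refinement

-- Regions and subdivisions are products of the following sets of coordinates.
Strip : (Fin k → Fin n) → Fin (suc k) → Pred (Fin n) 0ℓ
Strip α i x = extend α (inject₁ i) < coord x × coord x < extend α (suc i)

Interval : (Fin k → Fin n) → Fin (suc k) → Pred (Fin (suc n)) 0ℓ
Interval α i u = extend α (inject₁ i) ≤ toℕ u × toℕ u < extend α (suc i)

-- The first index at which `f` exceeds `v` ends the required step, so no monotonicity of `f` is
-- assumed. Applied to `extend α`, this locates a coordinate among the grid lines.
discrete-ivt : (f : Fin (suc (suc k)) → ℕ) {v : ℕ} → f zero ≤ v → v < f (suc (fromℕ k)) →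
               ∃[ u ] (f (inject₁ u) ≤ v × v < f (suc u))
discrete-ivt {zero}  f     f₀≤v v<f₁ = zero , f₀≤v , v<f₁
discrete-ivt {suc k} f {v} f₀≤v v<fₗ with v <? f (suc zero)
... | yes v<f₁ = zero , f₀≤v , v<f₁
... | no  v≮f₁ with discrete-ivt (f ∘ suc) (ℕ.≮⇒≥ v≮f₁) v<fₗ
... | u , p , q = suc u , p , q

image-or-strip : (α : Fin k → Fin n) (x : Fin n) →
                 (∃[ i ] x ≡ α i) ⊎ (∃[ u ] x ∈ Strip α u)
image-or-strip {k} {n} α x
  with discrete-ivt (extend α) {coord x} z≤n
         (ℕ.≤-trans (s≤s (Fin.toℕ<n x)) (ℕ.≤-reflexive (sym (extend-fromℕ α))))
... | u , p , q with ℕ.m≤n⇒m<n∨m≡n p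
... | inj₁ p< = inj₂ (u , p< , q)
... | inj₂ p≡ with u
-- `u` cannot be `zero`: the lowest grid line has coordinate 0, while `coord x` is at least 1.
... | suc i = inj₁ (i , Fin.toℕ-injective (ℕ.suc-injective (trans (sym p≡) (extend-inject₁ α i))))

module _ {α : Fin l → Fin n} (γ : Fin k → Fin l)
         (α≤ : α Preserves Fin._≤_ ⟶ Fin._≤_) where

  -- If `j` violated a bound of the strip of `γ`, monotonicity would carry the violation over to
  -- `α j`. This pulls a point of an occurrence back into the pattern.
  strip-∘⁻ : ∀ {i} j → α j ∈ Strip (α ∘ γ) i → j ∈ Strip γ i
  strip-∘⁻ {i} j (lo , hi) =
    (ℕ.≰⇒> λ j≤ → ℕ.<⇒≱ lo (subst (_≤ _) (extend-inject₁ α j)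
      (extend-∘-≥ γ α≤ (λ _ → refl) {suc (inject₁ j)} {inject₁ i} (ℕ.≤-trans (ℕ.≤-reflexive j′) j≤)))) ,
    (ℕ.≰⇒> λ ≤j → ℕ.<⇒≱ hi (subst (_ ≤_) (extend-inject₁ α j)
      (extend-∘-≤ γ α≤ (λ _ → refl) {suc (inject₁ j)} {suc i} (ℕ.≤-trans ≤j (ℕ.≤-reflexive (sym j′))))))
    where
    j′ : toℕ (suc (inject₁ j)) ≡ coord j
    j′ = cong suc (Fin.toℕ-inject₁ j)

  -- For `u` outside the interval, the fine strip `u` would lie entirely before or entirely after
  -- the coarse strip `i`, and the two could not share `x`.
  strip-∘⇒interval : ∀ {i u x} → x ∈ Strip (α ∘ γ) i → x ∈ Strip α u → u ∈ Interval γ i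
  strip-∘⇒interval {i} {u} (lo , hi) (lo′ , hi′) =
    (ℕ.≮⇒≥ λ u< → ℕ.<-asym (ℕ.<-≤-trans hi′
      (extend-∘-≥ γ α≤ (λ _ → refl) {suc u} {inject₁ i} u<)) lo) ,
    (ℕ.≰⇒> λ ≤u → ℕ.<-asym (ℕ.<-≤-trans hi
      (extend-∘-≤ γ α≤ (λ _ → refl) {inject₁ u} {suc i}
        (subst (_ ≤_) (sym (Fin.toℕ-inject₁ u)) ≤u))) lo′)

-- Every grid line of `α` is one of `δ`, so a fine strip indexed within the interval cannot leave
-- the coarse strip. The pointwise equation allows `δ` to be an `insertAt`, which composes with
-- `punchIn` to `α` only propositionally.
interval-strip : {α : Fin k → Fin n} {δ : Fin l → Fin n} (γ : Fin k → Fin l) →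
                 δ Preserves Fin._≤_ ⟶ Fin._≤_ → (∀ i → δ (γ i) ≡ α i) →
                 ∀ {i u} → u ∈ Interval γ i → Strip δ u ⊆ Strip α i
interval-strip γ δ≤ eq {i} {u} (lo , hi) (lo′ , hi′) =
  ℕ.≤-<-trans (extend-∘-≤ γ δ≤ eq {inject₁ u} {inject₁ i}
    (subst (_ ≤_) (sym (Fin.toℕ-inject₁ u)) lo)) lo′ ,
  ℕ.<-≤-trans hi′ (extend-∘-≥ γ δ≤ eq {suc u} {suc i} hi)

-- Occurrences under change of shading and under passage to subpatterns

occurrence-plot : {p : MeshPattern} {ρ : Permutation′ n} (o : Occurrence p ρ) →
                  ∀ i → ρ ⟨$⟩ʳ α o i ≡ β o (perm p ⟨$⟩ʳ i)
occurrence-plot o i = ω⊆plot o (i , _ , refl , refl , refl)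

occurrence-antitone : {σ : Permutation′ k} {R S : Shading k} {ρ : Permutation′ n} →
                      R ⊆ S → Occurrence (mesh σ S) ρ → Occurrence (mesh σ R) ρ
occurrence-antitone R⊆S o = record
  { α = α o ; β = β o ; α-order = α-order o ; β-order = β-order o
  ; ω⊆plot = ω⊆plot o ; shaded-free = λ b∈R → shaded-free o (R⊆S b∈R) }

occurrence-∪ : {σ : Permutation′ k} {R S : Shading k} {ρ : Permutation′ n}
               (o : Occurrence (mesh σ R) ρ) →
               (∀ {b} → b ∈ S → Empty (Region (α o) (β o) b ∩ Plot ρ)) →
               Occurrence (mesh σ (R ∪ S)) ρ
occurrence-∪ o free = record
  { α = α o ; β = β o ; α-order = α-order o ; β-order = β-order o
  ; ω⊆plot = ω⊆plot o
  ; shaded-free = λ where (inj₁ b∈R) → shaded-free o b∈R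
                          (inj₂ b∈S) → free b∈S }

-- The injections compose. A point of `ρ` in a region to be kept empty either belongs to the
-- occurrence of `q`, and then contradicts emptiness for `s` inside `κ`, or lies inside a box of `q`
-- that `sub` shows to be shaded.
subpattern-occurrence : {p q : MeshPattern} {ρ : Permutation′ n} →
                        p IsSubpatternOf q → Occurrence q ρ → Occurrence p ρ
subpattern-occurrence {p = p} {q} {ρ} (s , sub) o = record
  { α = α o ∘ α s
  ; β = β o ∘ β s
  ; α-order = opi-∘ {γ = α s} (α-order o) (α-order s)
  ; β-order = opi-∘ {γ = β s} (β-order o) (β-order s)
  ; ω⊆plot = λ where
      (i , _ , refl , refl , refl) →
        trans (occurrence-plot o (α s i)) (cong (β o) (occurrence-plot s i))
  ; shaded-free = free
  }
  where
  κ : Permutation′ (size q)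
  κ = perm q

  α≤ : α o Preserves Fin._≤_ ⟶ Fin._≤_
  α≤ = proj₁ (α-order o)

  β≤ : β o Preserves Fin._≤_ ⟶ Fin._≤_
  β≤ = proj₁ (β-order o)

  free-at-point : ∀ {b} → b ∈ shading p → ∀ i →
                  ¬ ((α o i , β o (κ ⟨$⟩ʳ i)) ∈ Region (α o ∘ α s) (β o ∘ β s) b)
  free-at-point b∈ i (inα , inβ) =
    shaded-free s b∈ (i , κ ⟨$⟩ʳ i)
      ((strip-∘⁻ (α s) α≤ i inα , strip-∘⁻ (β s) β≤ (κ ⟨$⟩ʳ i) inβ) , refl)

  free : ∀ {b} → b ∈ shading p → Empty (Region (α o ∘ α s) (β o ∘ β s) b ∩ Plot ρ)
  free {b} b∈ (x , y) ((inα , inβ) , ρx≡y) with image-or-strip (α o) x | image-or-strip (β o) y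
  ... | inj₁ (i , refl) | _ =
    free-at-point b∈ i (inα , subst (Strip (β o ∘ β s) (proj₂ b)) (trans (sym ρx≡y) (occurrence-plot o i)) inβ)
  -- Row `y` is used by the occurrence of `q`. As `ρ` is injective, its point in that row is the
  -- image of the point of `κ` with value `j`, so column `x` is used as well.
  ... | inj₂ _ | inj₁ (j , refl) =
    free-at-point b∈ i
      ( subst (Strip (α o ∘ α s) (proj₁ b)) x≡αi inα
      , subst (Strip (β o ∘ β s) (proj₂ b)) (cong (β o) (sym κi≡j)) inβ)
    where
    i : Fin (size q)
    i = κ ⟨$⟩ˡ j

    κi≡j : κ ⟨$⟩ʳ i ≡ j
    κi≡j = inverseʳ κ

    x≡αi : x ≡ α o i
    x≡αi = Injection.injective (↔⇒↣ ρ)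
      (trans ρx≡y (trans (cong (β o) (sym κi≡j)) (sym (occurrence-plot o i))))
  -- The point is on no grid line of `o`, hence in the interior of a single box `(u , v)` of `q`.
  ... | inj₂ (u , inu) | inj₂ (v , inv) =
    shaded-free o
      (sub b∈ (strip-∘⇒interval (α s) α≤ inα inu , strip-∘⇒interval (β s) β≤ inβ inv))
      (x , y) ((inu , inv) , ρx≡y)

-- Index arithmetic of point insertion

data PunchView (i : Fin (suc k)) : Fin (suc k) → Set where
  hole    : PunchView i i
  punched : ∀ j → PunchView i (punchIn i j)

punchView : (i a : Fin (suc k)) → PunchView i a
punchView i a with i Fin.≟ a
... | yes refl = hole
... | no  i≢a  = subst (PunchView i) (Fin.punchIn-punchOut i≢a) (punched _)

<punchIn⇒≤ : ∀ (i : Fin (suc k)) j → i Fin.< punchIn i j → i Fin.≤ j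
<punchIn⇒≤ zero    _       _       = z≤n
<punchIn⇒≤ (suc i) (suc j) (s≤s p) = s≤s (<punchIn⇒≤ i j p)

punchIn<⇒< : ∀ (i : Fin (suc k)) j → punchIn i j Fin.< i → j Fin.< i
punchIn<⇒< (suc i) zero    _       = s≤s z≤n
punchIn<⇒< (suc i) (suc j) (s≤s p) = s≤s (punchIn<⇒< i j p)

pinch≡suc⇒punchIn< : ∀ (i : Fin (suc k)) u {w} → pinch i u ≡ suc w → punchIn i w Fin.< u
pinch≡suc⇒punchIn< zero    (suc _) refl = ℕ.≤-refl
pinch≡suc⇒punchIn< (suc i) (suc u) {zero}  eq = s≤s z≤n
pinch≡suc⇒punchIn< (suc i) (suc u) {suc w} eq =
  s≤s (pinch≡suc⇒punchIn< i u (Fin.suc-injective eq))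

pinch≡inject₁⇒≤punchIn : ∀ (i : Fin (suc k)) u {w} → pinch i u ≡ inject₁ w →
                         toℕ u ≤ toℕ (punchIn i w)
pinch≡inject₁⇒≤punchIn zero    zero    _ = z≤n
pinch≡inject₁⇒≤punchIn zero    (suc u) {w} eq =
  s≤s (ℕ.≤-reflexive (trans (cong toℕ eq) (Fin.toℕ-inject₁ w)))
pinch≡inject₁⇒≤punchIn (suc i) zero    _ = z≤n
pinch≡inject₁⇒≤punchIn (suc i) (suc u) {suc w} eq =
  s≤s (pinch≡inject₁⇒≤punchIn i u (Fin.suc-injective eq))

-- Links `insertShading`, given by `pinch`, with the geometry of the refined grid. If `pinch i u` is
-- `suc w`, then `u` is beyond the old point `w`, whose new index is `punchIn i w`; the upper bound
-- is dual.
pinch-interval : ∀ (i : Fin (suc k)) u → u ∈ Interval (punchIn i) (pinch i u)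
pinch-interval {k} i u = lower , upper
  where
  lower : extend (punchIn i) (inject₁ (pinch i u)) ≤ toℕ u
  lower with pinch i u in eq
  ... | zero  = z≤n
  ... | suc w = subst (_≤ toℕ u) (sym (extend-inject₁ (punchIn i) w)) (pinch≡suc⇒punchIn< i u eq)

  upper : toℕ u < extend (punchIn i) (suc (pinch i u))
  upper with pinch i u in eq
  ... | t with view t
  ...   | ‵fromℕ     = subst (toℕ u <_) (sym (extend-fromℕ (punchIn i))) (Fin.toℕ<n u)
  ...   | ‵inject₁ w =
    subst (toℕ u <_) (sym (extend-inject₁ (punchIn i) w)) (s≤s (pinch≡inject₁⇒≤punchIn i u eq))

pinch-inject₁ : ∀ (i : Fin (suc k)) → pinch i (inject₁ i) ≡ i
pinch-inject₁         zero    = refl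
pinch-inject₁ {suc k} (suc i) = cong suc (pinch-inject₁ i)

pinch-suc : ∀ (i : Fin (suc k)) → pinch i (suc i) ≡ i
pinch-suc         zero    = refl
pinch-suc {suc k} (suc i) = cong suc (pinch-suc i)

-- Inserting a coordinate into an order-preserving injection

module InsertAt {α : Fin k → Fin n} (α-opi : OrderPreservingInjection α)
                {i : Fin (suc k)} {x : Fin n} (x∈ : x ∈ Strip α i) where

  α⁺ : Fin (suc k) → Fin n
  α⁺ = Vector.insertAt α i x

  α⁺-hole : α⁺ i ≡ x
  α⁺-hole = insertAt-lookup α i x

  α⁺-punched : ∀ j → α⁺ (punchIn i j) ≡ α j
  α⁺-punched = insertAt-punchIn α i x

  -- Membership in strip `i` places `x` strictly between its two neighbours, and monotonicity of
  -- `extend α` passes this on to all other old values.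
  strictlyMonotone : StrictlyMonotone α⁺
  strictlyMonotone {a} {b} a<b with punchView i a | punchView i b
  ... | hole      | hole      = contradiction a<b (ℕ.<-irrefl refl)
  ... | hole      | punched j =
    subst₂ Fin._<_ (sym α⁺-hole) (sym (α⁺-punched j)) (s≤s⁻¹ (ℕ.<-≤-trans (proj₂ x∈)
      (subst (_ ≤_) (extend-inject₁ α j) (extend-mono α (proj₁ α-opi) {suc i} {suc (inject₁ j)}
        (s≤s (subst (_ ≤_) (sym (Fin.toℕ-inject₁ j)) (<punchIn⇒≤ i j a<b)))))))
  ... | punched j | hole      =
    subst₂ Fin._<_ (sym (α⁺-punched j)) (sym α⁺-hole) (s≤s⁻¹ (ℕ.≤-<-trans
      (subst (_≤ _) (extend-inject₁ α j) (extend-mono α (proj₁ α-opi) {suc (inject₁ j)} {inject₁ i}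
        (subst₂ _≤_ (cong suc (sym (Fin.toℕ-inject₁ j))) (sym (Fin.toℕ-inject₁ i))
          (punchIn<⇒< i j a<b)))) (proj₁ x∈)))
  ... | punched j | punched l =
    subst₂ Fin._<_ (sym (α⁺-punched j)) (sym (α⁺-punched l))
      (opi⇒strictlyMonotone α-opi (ℕ.≰⇒> λ l≤j → ℕ.<⇒≱ a<b (Fin.punchIn-mono-≤ i l j l≤j)))

  opi : OrderPreservingInjection α⁺
  opi = strictlyMonotone⇒opi strictlyMonotone

  strip-pinch : ∀ u → Strip α⁺ u ⊆ Strip α (pinch i u)
  strip-pinch u = interval-strip (punchIn i) (proj₁ opi) α⁺-punched (pinch-interval i u)

  -- The new line `x` cuts strip `i` into the parts `inject₁ i` and `suc i`, both sent back to `i`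
  -- by `pinch i`. Products of such parts are the four boxes around the inserted point.
  strip-before : ∀ {z} → z ∈ Strip α⁺ (inject₁ i) → z ∈ Strip α i × z Fin.< x
  strip-before {z} z∈ =
    subst (λ t → z ∈ Strip α t) (pinch-inject₁ i) (strip-pinch (inject₁ i) z∈) ,
    s≤s⁻¹ (ℕ.<-≤-trans (proj₂ z∈)
      (ℕ.≤-reflexive (trans (extend-inject₁ α⁺ i) (cong coord α⁺-hole))))

  strip-after : ∀ {z} → z ∈ Strip α⁺ (suc i) → z ∈ Strip α i × x Fin.< z
  strip-after {z} z∈ =
    subst (λ t → z ∈ Strip α t) (pinch-suc i) (strip-pinch (suc i) z∈) ,
    s≤s⁻¹ (ℕ.≤-<-trans
      (ℕ.≤-reflexive (trans (cong coord (sym α⁺-hole)) (sym (extend-inject₁ α⁺ i)))) (proj₁ z∈))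

-- Extremal points of a region and occurrences of the star patterns

insert-lookup : ∀ (i j : Fin (suc k)) (τ : Permutation′ k) → insert i j τ ⟨$⟩ʳ i ≡ j
insert-lookup i j τ with i Fin.≟ i
... | yes _   = refl
... | no  i≢i = contradiction refl i≢i

-- Order and key are parameters so that one search yields all four extremal points. The witness `w`
-- is the starting candidate, which guarantees that the result satisfies `P`.
argmin-Fin : (O : TotalOrder 0ℓ 0ℓ 0ℓ) (f : Fin n → TotalOrder.Carrier O)
             {P : Pred (Fin n) 0ℓ} → Decidable P → ∃ P →
             ∃[ x ] (P x × (∀ {z} → P z → TotalOrder._≤_ O (f x) (f z)))
argmin-Fin {n} O f {P} P? (w , Pw) =
  argmin f w xs ,
  argmin-all f Pw (all-filter P? (allFin n)) ,
  λ {z} Pz → All.lookup (f[argmin]≤f[xs] w xs) (∈-filter⁺ P? (∈-allFin z) Pz)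
  where
  open Extrema O
  xs = filter P? (allFin n)

module _ {σ : Permutation′ k} {R : Shading k} {ρ : Permutation′ n}
         (o : Occurrence (mesh σ R) ρ) (c : Box k) where

  private
    i j : Fin (suc k)
    i = proj₁ c
    j = proj₂ c

  -- A point of the plot is represented by its position alone, so that searching the region is a
  -- search over `Fin n`.
  InRegion : Pred (Fin n) 0ℓ
  InRegion x = (x , ρ ⟨$⟩ʳ x) ∈ Region (α o) (β o) c

  inRegion? : Decidable InRegion
  inRegion? x = (_ <? _ ×-dec _ <? _) ×-dec (_ <? _ ×-dec _ <? _)

  module Insertion {x : Fin n} (x∈ : InRegion x) where

    module A = InsertAt (α-order o) (proj₁ x∈)
    module B = InsertAt (β-order o) (proj₂ x∈)

    -- Each box of the refined grid lies in the region of the old box that `pinch` assigns to it,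
    -- and it is shaded exactly when that old box is; so emptiness is inherited from `o`.
    insertion : Occurrence (insertPoint (mesh σ R) c) ρ
    insertion = record
      { α = A.α⁺
      ; β = B.α⁺
      ; α-order = A.opi
      ; β-order = B.opi
      ; ω⊆plot = λ where (a , _ , refl , refl , refl) → plot a
      ; shaded-free = λ {b} → free {b}
      }
      where
      free : ∀ {b} → b ∈ insertShading R c → Empty (Region A.α⁺ B.α⁺ b ∩ Plot ρ)
      free {u , v} b∈ (x , y) ((inα , inβ) , eq) =
        shaded-free o b∈ (x , y) ((A.strip-pinch u inα , B.strip-pinch v inβ) , eq)

      plot : ∀ a → ρ ⟨$⟩ʳ A.α⁺ a ≡ B.α⁺ (insert i j σ ⟨$⟩ʳ a)
      plot a with punchView i a
      ... | hole =
        trans (cong (ρ ⟨$⟩ʳ_) A.α⁺-hole)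
          (trans (sym B.α⁺-hole) (cong B.α⁺ (sym (insert-lookup i j σ))))
      ... | punched b =
        trans (cong (ρ ⟨$⟩ʳ_) (A.α⁺-punched b)) (trans (occurrence-plot o b)
          (trans (sym (B.α⁺-punched _)) (cong B.α⁺ (sym (insert-punchIn i j σ b)))))

    i₀ i₁ j₀ j₁ : Fin (suc (suc k))
    i₀ = inject₁ i
    i₁ = suc i
    j₀ = inject₁ j
    j₁ = suc j

    Region⁺ : Box (suc k) → Pred (Fin n × Fin n) 0ℓ
    Region⁺ = Region A.α⁺ B.α⁺

    -- Both boxes above the inserted point lie in the region of `c`, so a point in one of them would
    -- be higher than the maximum. The other three directions follow the same pattern.
    topmost-free : (∀ {z} → InRegion z → ρ ⟨$⟩ʳ z Fin.≤ ρ ⟨$⟩ʳ x) →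
                   ∀ {b} → b ∈ ｛ i₀ , j₁ ｝ ∪ ｛ i₁ , j₁ ｝ → Empty (Region⁺ b ∩ Plot ρ)
    topmost-free max (inj₁ refl) (z , _) ((p , q) , refl) =
      ℕ.<⇒≱ (proj₂ (B.strip-after q)) (max (proj₁ (A.strip-before p) , proj₁ (B.strip-after q)))
    topmost-free max (inj₂ refl) (z , _) ((p , q) , refl) =
      ℕ.<⇒≱ (proj₂ (B.strip-after q)) (max (proj₁ (A.strip-after p) , proj₁ (B.strip-after q)))

    rightmost-free : (∀ {z} → InRegion z → z Fin.≤ x) →
                     ∀ {b} → b ∈ ｛ i₁ , j₀ ｝ ∪ ｛ i₁ , j₁ ｝ → Empty (Region⁺ b ∩ Plot ρ)
    rightmost-free max (inj₁ refl) (z , _) ((p , q) , refl) =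
      ℕ.<⇒≱ (proj₂ (A.strip-after p)) (max (proj₁ (A.strip-after p) , proj₁ (B.strip-before q)))
    rightmost-free max (inj₂ refl) (z , _) ((p , q) , refl) =
      ℕ.<⇒≱ (proj₂ (A.strip-after p)) (max (proj₁ (A.strip-after p) , proj₁ (B.strip-after q)))

    bottommost-free : (∀ {z} → InRegion z → ρ ⟨$⟩ʳ x Fin.≤ ρ ⟨$⟩ʳ z) →
                      ∀ {b} → b ∈ ｛ i₀ , j₀ ｝ ∪ ｛ i₁ , j₀ ｝ → Empty (Region⁺ b ∩ Plot ρ)
    bottommost-free min (inj₁ refl) (z , _) ((p , q) , refl) =
      ℕ.<⇒≱ (proj₂ (B.strip-before q)) (min (proj₁ (A.strip-before p) , proj₁ (B.strip-before q)))
    bottommost-free min (inj₂ refl) (z , _) ((p , q) , refl) =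
      ℕ.<⇒≱ (proj₂ (B.strip-before q)) (min (proj₁ (A.strip-after p) , proj₁ (B.strip-before q)))

    leftmost-free : (∀ {z} → InRegion z → x Fin.≤ z) →
                    ∀ {b} → b ∈ ｛ i₀ , j₀ ｝ ∪ ｛ i₀ , j₁ ｝ → Empty (Region⁺ b ∩ Plot ρ)
    leftmost-free min (inj₁ refl) (z , _) ((p , q) , refl) =
      ℕ.<⇒≱ (proj₂ (A.strip-before p)) (min (proj₁ (A.strip-before p) , proj₁ (B.strip-before q)))
    leftmost-free min (inj₂ refl) (z , _) ((p , q) , refl) =
      ℕ.<⇒≱ (proj₂ (A.strip-before p)) (min (proj₁ (A.strip-before p) , proj₁ (B.strip-after q)))

  star-occurrences : ∃ InRegion → All (λ m → Occurrence m ρ) (star (mesh σ R) c)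
  star-occurrences w
    -- Maxima are minima of the flipped order; the key `ρ ⟨$⟩ʳ_` compares heights and `id` compares
    -- positions. The searches follow the order of the list `star`.
    with argmin-Fin (Flip.totalOrder (Fin.≤-totalOrder n)) (ρ ⟨$⟩ʳ_) inRegion? w
       | argmin-Fin (Flip.totalOrder (Fin.≤-totalOrder n)) id inRegion? w
       | argmin-Fin (Fin.≤-totalOrder n) (ρ ⟨$⟩ʳ_) inRegion? w
       | argmin-Fin (Fin.≤-totalOrder n) id inRegion? w
  ... | _ , t∈ , top | _ , r∈ , right | _ , b∈ , bottom | _ , l∈ , left =
      insertion (proj₂ w)
    ∷ occurrence-∪ (insertion t∈) (topmost-free t∈ top)
    ∷ occurrence-∪ (insertion r∈) (rightmost-free r∈ right)
    ∷ occurrence-∪ (insertion b∈) (bottommost-free b∈ bottom)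
    ∷ occurrence-∪ (insertion l∈) (leftmost-free l∈ left)
    ∷ []
    where open Insertion

-- The two inclusions between the avoidance classes

proposition3p9 : ∀ {k n : ℕ} (σ : Permutation′ k) (π : Permutation′ n) (R₁ R₂ : Shading k) (c : Box k) →
    c ∉ R₁ →
    R₂ ≐ R₁ ∪ ｛ c ｝ →
    Any (λ m → ∃[ q ] (CoincidentUnder π m q × mesh σ R₂ IsSubpatternOf q)) (star (mesh σ R₁) c) →
    CoincidentUnder π (mesh σ R₁) (mesh σ R₂)
proposition3p9 σ π R₁ R₂ c _ (R₂⊆ , ⊆R₂) coincident = to , from
  where
  to : Av (｛ classical π ｝ ∪ ｛ mesh σ R₁ ｝) ⊆ Av (｛ classical π ｝ ∪ ｛ mesh σ R₂ ｝)
  to avoids (inj₁ refl) = avoids (inj₁ refl)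
  to avoids (inj₂ refl) = avoids (inj₂ refl) ∘ occurrence-antitone (⊆R₂ ∘ inj₁)

  from : Av (｛ classical π ｝ ∪ ｛ mesh σ R₂ ｝) ⊆ Av (｛ classical π ｝ ∪ ｛ mesh σ R₁ ｝)
  from avoids (inj₁ refl) = avoids (inj₁ refl)
  from {_ , ρ} avoids (inj₂ refl) o with Fin.any? (inRegion? o c)
  -- With no point of `ρ` in the region, `c` may be shaded as well, which makes `o` an occurrence of
  -- `mesh σ R₂`.
  ... | no none =
    avoids (inj₂ refl) (occurrence-antitone R₂⊆ (occurrence-∪ o λ where
      refl (x , _) (x∈ , refl) → none (x , x∈)))
  ... | yes w with All.lookupAny (star-occurrences o c w) coincident
  -- `om` is an occurrence of the very star pattern that is coincident with `q`. Since avoidance is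
  -- a negation, the argument runs contrapositively: `ρ` avoids `mesh σ R₂`, hence `q`, hence that
  -- star pattern, against `om`.
  ... | om , q , (_ , avq⊆avm) , sub = avq⊆avm avoids-q (inj₂ refl) om
    where
    avoids-q : Av (｛ classical π ｝ ∪ ｛ q ｝) (_ , ρ)
    avoids-q (inj₁ refl) = avoids (inj₁ refl)
    avoids-q (inj₂ refl) = avoids (inj₂ refl) ∘ subpattern-occurrence sub
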